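{- Let $k\ge 1$ be an integer. If $G$ is a graph of order at least $k$, then $L_k(G)+L_k(\overline{G})\geq 2k$. Moreover, $L_k(G)+L_k(\overline{G})=2k$ if and only if $G$ has one of the following properties: (i) $G$ has exactly $k$ vertices; (ii) for each $(k+1)$-subset $X$ of $V(G)$, at least one of the following holds: (a) $G[X]$ has maximum degree $k$ and there is a vertex outside $X$ that is not adjacent to any vertex of $X$; (b) there is a vertex outside $X$ that is adjacent to all the vertices of $X$, and $G[X]$ has an isolated vertex; (c) there are a vertex outside $X$ that is adjacent to all the vertices of $X$ and another vertex outside $X$ that is not adjacent to any vertex of $X$.
   Context: All graphs are finite, undirected, simple and nontrivial (at least two vertices). $\overline{G}$ is the complement of $G$, $G[X]$ the subgraph induced by $X$, and $N[v]=\{v\}\cup N(v)$ the closed neighbourhood of $v$. For an integer $k\ge 1$, a set $B\subseteq V(G)$ is a $k$-limited packing if $|N[v]\cap B|\le k$ for every vertex $v$ of $G$; $L_k(G)$ is the maximum cardinality of a $k$-limited packing in $G$. When (ii) is considered, $G$ has order at least $k+1$ (so that there are $(k+1)$-subsets). -}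

module Defs where

open import Data.Nat using (ℕ; zero; suc; _≤_; _≤?_)
open import Data.Fin using (Fin; zero; suc; _≟_)
open import Data.Fin.Properties using (all?)
open import Data.Fin.Subset using (Subset; inside; outside; _∈_; _∉_; _∪_; _∩_; ⁅_⁆; ∣_∣)
open import Data.List using (List; []; _∷_; _++_; map; filter; allFin)
open import Data.List.Extrema.Nat using (max)
open import Data.List.Membership.Propositional using () renaming (_∈_ to _∈ˡ_)
open import Data.List.Membership.Propositional.Properties using (∈-map⁺; ∈-++⁺ˡ; ∈-++⁺ʳ)
open import Data.List.Relation.Unary.Any using (here)
open import Data.Product using (_×_; _,_; ∃-syntax)
open import Data.Sum using (_⊎_)
open import Data.Vec using (tabulate; []; _∷_; here; there)
open import Level using (0ℓ)
open import Relation.Binary using (Rel; Decidable; Symmetric; Irreflexive)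
open import Relation.Binary.PropositionalEquality using (_≡_; _≢_; refl; sym)
open import Relation.Nullary using (¬_; Dec; does; ¬?; _×-dec_)

-- Adjacency in a finite graph is decidable, which constructively has to be
-- part of the structure.
record Graph (n : ℕ) : Set₁ where
  field
    _~_      : Rel (Fin n) 0ℓ
    _~?_     : Decidable _~_
    ~-sym    : Symmetric _~_
    ~-irrefl : Irreflexive _≡_ _~_

private
  variable
    n : ℕ

complement : Graph n → Graph n
complement G = record
  { _~_      = λ u v → u ≢ v × ¬ (u ~ v)
  ; _~?_     = λ u v → ¬? (u ≟ v) ×-dec ¬? (u ~? v)
  ; ~-sym    = λ (u≢v , u≁v) → (λ v≡u → u≢v (sym v≡u)) , (λ v~u → u≁v (~-sym v~u))
  ; ~-irrefl = λ u≡v (u≢v , _) → u≢v u≡v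
  }
  where open Graph G

-- The i-th element of X, in increasing order.
element : (X : Subset n) → Fin ∣ X ∣ → Fin n
element (outside ∷ X) i       = suc (element X i)
element (inside  ∷ X) zero    = zero
element (inside  ∷ X) (suc i) = suc (element X i)

element-∈ : (X : Subset n) (i : Fin ∣ X ∣) → element X i ∈ X
element-∈ (outside ∷ X) i       = there (element-∈ X i)
element-∈ (inside  ∷ X) zero    = here
element-∈ (inside  ∷ X) (suc i) = there (element-∈ X i)

-- G[X], with the vertices of X renumbered by element.
induced : Graph n → (X : Subset n) → Graph ∣ X ∣
induced G X = record
  { _~_      = λ i j → element X i ~ element X j
  ; _~?_     = λ i j → element X i ~? element X j
  ; ~-sym    = ~-sym
  ; ~-irrefl = λ { refl → ~-irrefl refl }
  }
  where open Graph G

neighbourhood : Graph n → Fin n → Subset n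
neighbourhood G v = tabulate λ u → does (v ~? u)
  where open Graph G

closedNeighbourhood : Graph n → Fin n → Subset n
closedNeighbourhood G v = ⁅ v ⁆ ∪ neighbourhood G v

degree : Graph n → Fin n → ℕ
degree G v = ∣ neighbourhood G v ∣

maxDegree : Graph n → ℕ
maxDegree {n} G = max 0 (map (degree G) (allFin n))

Isolated : Graph n → Fin n → Set
Isolated G v = degree G v ≡ 0

IsLimitedPacking : ℕ → Graph n → Subset n → Set
IsLimitedPacking k G B = ∀ v → ∣ closedNeighbourhood G v ∩ B ∣ ≤ k

isLimitedPacking? : (k : ℕ) (G : Graph n) (B : Subset n) → Dec (IsLimitedPacking k G B)
isLimitedPacking? k G B = all? λ v → ∣ closedNeighbourhood G v ∩ B ∣ ≤? k

subsets : ∀ n → List (Subset n)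
subsets zero    = [] ∷ []
subsets (suc n) = map (outside ∷_) (subsets n) ++ map (inside ∷_) (subsets n)

∈-subsets : (B : Subset n) → B ∈ˡ subsets n
∈-subsets []            = here refl
∈-subsets (outside ∷ B) = ∈-++⁺ˡ (∈-map⁺ (outside ∷_) (∈-subsets B))
∈-subsets (inside  ∷ B) = ∈-++⁺ʳ (map (outside ∷_) (subsets _)) (∈-map⁺ (inside ∷_) (∈-subsets B))

-- The default value 0 is harmless: the empty set is always a k-limited packing.
L : ℕ → Graph n → ℕ
L {n} k G = max 0 (map ∣_∣ (filter (isLimitedPacking? k G) (subsets n)))

AdjacentToAll : Graph n → Subset n → Fin n → Set
AdjacentToAll G X v = ∀ {x} → x ∈ X → v ~ x
  where open Graph G

AdjacentToNone : Graph n → Subset n → Fin n → Set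
AdjacentToNone G X v = ∀ {x} → x ∈ X → ¬ (v ~ x)
  where open Graph G

ConditionA : ℕ → Graph n → Subset n → Set
ConditionA k G X =
  maxDegree (induced G X) ≡ k × (∃[ v ] v ∉ X × AdjacentToNone G X v)

ConditionB : Graph n → Subset n → Set
ConditionB G X =
  (∃[ v ] v ∉ X × AdjacentToAll G X v) × (∃[ x ] Isolated (induced G X) x)

ConditionC : Graph n → Subset n → Set
ConditionC G X =
  ∃[ v ] ∃[ w ] v ≢ w × (v ∉ X × AdjacentToAll G X v) × (w ∉ X × AdjacentToNone G X w)

PropertyII : ℕ → Graph n → Set
PropertyII {n} k G =
  suc k ≤ n ×
  (∀ (X : Subset n) → ∣ X ∣ ≡ suc k → ConditionA k G X ⊎ ConditionB G X ⊎ ConditionC G X)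

{-# OPTIONS --safe #-}
-- Every set of at most k vertices is a k-limited packing, and subsets of
-- k-limited packings are again such. Hence L k G ≥ k, with equality iff every
-- (k+1)-set X lies in some closed neighbourhood N[v]. So the sum is 2k iff
-- every (k+1)-set X lies in some N[v] of G and in some N[w] of the complement.
-- If v ∈ X then v has degree k in G[X]; if w ∈ X then w is isolated in G[X].
-- Since k ≥ 1, v and w cannot both be in X; the other three possibilities are
-- (a), (b) and (c).
module Submission where

open import Defs
open import Data.Nat using (ℕ; zero; suc; _+_; _*_; _∸_; _≤_; _<_; z≤n; s≤s; s≤s⁻¹)
open import Data.Nat.Properties
  using (≤-refl; ≤-reflexive; ≤-trans; ≤-antisym; ≰⇒>; ≮⇒≥; <⇒≱; ≤∧≢⇒<;
         +-mono-≤; +-cancelˡ-≤; +-monoˡ-≤; +-identityʳ; +-comm; suc-injective; _≤?_)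
  renaming (_≟_ to _≟ⁿ_)
open import Data.Fin using (Fin; zero; suc; _≟_)
open import Data.Fin.Properties using (¬∀⟶∃¬) renaming (suc-injective to Fin-suc-injective)
open import Data.Fin.Subset
  using (Subset; inside; outside; _∈_; _∉_; _⊆_; _∩_; ∁; ⁅_⁆; ∣_∣)
  renaming (⊤ to full; ⊥ to ∅)
open import Data.Fin.Subset.Properties
  using (_∈?_; p⊂q⇒∣p∣<∣q∣; p⊆q⇒∣p∣≤∣q∣; ∣p∣≤n; ∣⊤∣≡n; ∣⊥∣≡0; ∣p∩q∣≤∣q∣; p∩q⊆p; p∩q⊆q;
         x∈p∩q⁺; x∈p∪q⁺; x∈p∪q⁻; x∈⁅x⁆; x∈⁅y⁆⇒x≡y; x∉p⇒x∈∁p; x∈∁p⇒x∉p;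
         ∣∁p∣≡n∸∣p∣; ∣⁅x⁆∣≡1; Empty-unique; ∉⊥; ⊥⊆; in⊆in; out⊆)
open import Data.List using (allFin)
open import Data.List.Extrema.Nat using (argmax-all; xs≤max; max≈v⁺)
open import Data.List.Membership.Propositional.Properties using (∈-map⁺; ∈-filter⁺; ∈-allFin)
open import Data.List.Relation.Unary.All using (lookup; universal) renaming (map to map-All)
open import Data.List.Relation.Unary.All.Properties using (all-filter) renaming (map⁺ to All-map⁺)
open import Data.Product using (_×_; _,_; proj₁; proj₂; ∃-syntax)
open import Data.Sum using (_⊎_; inj₁; inj₂) renaming (map to map-⊎)
open import Data.Vec using (_∷_; here; there)
open import Data.Vec.Properties using ([]=⇒lookup; lookup⇒[]=; lookup∘tabulate)
open import Function using (id; _∘_)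
open import Function.Bundles using (_⇔_; mk⇔; module Equivalence)
open import Relation.Binary.PropositionalEquality
  using (_≡_; _≢_; refl; sym; trans; cong; subst)
open import Relation.Nullary using (¬_; Dec; yes; no; does; contradiction)
open import Relation.Nullary.Decidable using (dec-true)

open Equivalence using (to; from)

private
  variable
    n : ℕ

-- Finite subsets

-- An element of `q` outside `p` would make the inclusion strict, hence `p` strictly smaller. Counts
-- of neighbourhoods and intersections are turned back into inclusions this way.
p⊆q∧∣q∣≤∣p∣⇒q⊆p : {p q : Subset n} → p ⊆ q → ∣ q ∣ ≤ ∣ p ∣ → q ⊆ p
p⊆q∧∣q∣≤∣p∣⇒q⊆p {p = p} p⊆q ∣q∣≤∣p∣ {x} x∈q with x ∈? p
... | yes x∈p = x∈p
... | no  x∉p = contradiction ∣q∣≤∣p∣ (<⇒≱ (p⊂q⇒∣p∣<∣q∣ (p⊆q , x , x∈q , x∉p)))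

∣∁⁅x⁆∣ : (x : Fin n) → suc ∣ ∁ ⁅ x ⁆ ∣ ≡ n
∣∁⁅x⁆∣ {suc n} x = cong suc (trans (∣∁p∣≡n∸∣p∣ ⁅ x ⁆) (cong (suc n ∸_) (∣⁅x⁆∣≡1 x)))

subset-of-size : (X : Subset n) (m : ℕ) → m ≤ ∣ X ∣ → ∃[ Y ] Y ⊆ X × ∣ Y ∣ ≡ m
subset-of-size {n} X             zero    _   = ∅ , ⊥⊆ , ∣⊥∣≡0 n
subset-of-size     (outside ∷ X) (suc m) m<X with subset-of-size X (suc m) m<X
... | Y , Y⊆X , eq = outside ∷ Y , out⊆ Y⊆X , eq
subset-of-size     (inside ∷ X)  (suc m) m<X with subset-of-size X m (s≤s⁻¹ m<X)
... | Y , Y⊆X , eq = inside ∷ Y , in⊆in Y⊆X , cong suc eq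

-- Together with `element-surjective`, this identifies the vertices of `induced G X` with the
-- elements of `X`.
element-injective : (X : Subset n) {i j : Fin ∣ X ∣} → element X i ≡ element X j → i ≡ j
element-injective (outside ∷ X) {i}     {j}     eq = element-injective X (Fin-suc-injective eq)
element-injective (inside  ∷ X) {zero}  {zero}  eq = refl
element-injective (inside  ∷ X) {suc i} {suc j} eq =
  cong suc (element-injective X (Fin-suc-injective eq))

element-surjective : (X : Subset n) {x : Fin n} → x ∈ X → ∃[ i ] element X i ≡ x
element-surjective (outside ∷ X) (there x∈X) with element-surjective X x∈X
... | i , refl = i , refl
element-surjective (inside  ∷ X) here        = zero , refl
element-surjective (inside  ∷ X) (there x∈X) with element-surjective X x∈X
... | i , refl = suc i , refl

-- Degrees

module _ (G : Graph n) where
  open Graph G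

  -- Since `inside` is the Boolean `true`, membership in the tabulated vector is the value of the
  -- decision procedure.
  ∈-neighbourhood : (v : Fin n) {u : Fin n} → u ∈ neighbourhood G v ⇔ v ~ u
  ∈-neighbourhood v {u} = mk⇔
    (λ u∈N → does⇒ (v ~? u) (trans (sym (lookup∘tabulate _ u)) ([]=⇒lookup u∈N)))
    (λ v~u → lookup⇒[]= u _ (trans (lookup∘tabulate _ u) (dec-true (v ~? u) v~u)))
    where
    does⇒ : ∀ {A : Set} (a? : Dec A) → does a? ≡ inside → A
    does⇒ (yes a) _ = a

  ∈-closedNeighbourhood : (v : Fin n) {u : Fin n} → u ∈ closedNeighbourhood G v ⇔ (u ≡ v ⊎ v ~ u)
  ∈-closedNeighbourhood v = mk⇔
    (map-⊎ (x∈⁅y⁆⇒x≡y v) (to (∈-neighbourhood v)) ∘ x∈p∪q⁻ _ _)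
    (x∈p∪q⁺ ∘ map-⊎ (λ { refl → x∈⁅x⁆ v }) (from (∈-neighbourhood v)))

  neighbourhood⊆∁ : (v : Fin n) → neighbourhood G v ⊆ ∁ ⁅ v ⁆
  neighbourhood⊆∁ v u∈N = x∉p⇒x∈∁p λ u∈⁅v⁆ →
    ~-irrefl (sym (x∈⁅y⁆⇒x≡y v u∈⁅v⁆)) (to (∈-neighbourhood v) u∈N)

  degree<n : (v : Fin n) → degree G v < n
  degree<n v = subst (degree G v <_) (∣∁⁅x⁆∣ v) (s≤s (p⊆q⇒∣p∣≤∣q∣ (neighbourhood⊆∁ v)))

  -- The neighbourhood of `v` lies in `∁ ⁅ v ⁆`, which has one element fewer than the graph has
  -- vertices, so it has that size only if it is all of it.
  degree-full : (v : Fin n) → suc (degree G v) ≡ n ⇔ (∀ u → u ≢ v → v ~ u)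
  degree-full v = mk⇔
    (λ eq u u≢v → to (∈-neighbourhood v)
      (p⊆q∧∣q∣≤∣p∣⇒q⊆p (neighbourhood⊆∁ v)
        (≤-reflexive (suc-injective (trans (∣∁⁅x⁆∣ v) (sym eq))))
        (x∉p⇒x∈∁p (u≢v ∘ x∈⁅y⁆⇒x≡y v))))
    (λ v~ → ≤-antisym (degree<n v)
      (subst (_≤ suc (degree G v)) (∣∁⁅x⁆∣ v) (s≤s (p⊆q⇒∣p∣≤∣q∣ λ {u} u∈∁ →
        from (∈-neighbourhood v) (v~ u λ { refl → x∈∁p⇒x∉p u∈∁ (x∈⁅x⁆ v) })))))

  isolated⇔ : (v : Fin n) → Isolated G v ⇔ (∀ u → ¬ v ~ u)
  isolated⇔ v = mk⇔
    (λ deg≡0 u v~u → ∉⊥ (p⊆q∧∣q∣≤∣p∣⇒q⊆p ⊥⊆ (≤-reflexive (trans deg≡0 (sym (∣⊥∣≡0 n))))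
      (from (∈-neighbourhood v) v~u)))
    (λ v≁ → trans (cong ∣_∣ (Empty-unique λ (u , u∈N) → v≁ u (to (∈-neighbourhood v) u∈N)))
                  (∣⊥∣≡0 n))

  -- A positive maximum cannot be the default 0 of `max`, so it comes from the list of degrees.
  maxDegree-attained : 1 ≤ maxDegree G → ∃[ v ] degree G v ≡ maxDegree G
  maxDegree-attained = argmax-all id {P = λ d → 1 ≤ d → ∃[ v ] degree G v ≡ d}
    (λ ()) (All-map⁺ (universal (λ v _ → v , refl) (allFin n)))

  maxDegree≡ : (v : Fin n) → suc (degree G v) ≡ n → maxDegree G ≡ degree G v
  maxDegree≡ v eq = max≈v⁺ (∈-map⁺ (degree G) (∈-allFin v))
    (All-map⁺ (universal (λ u → s≤s⁻¹ (subst (degree G u <_) (sym eq) (degree<n u))) (allFin n)))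
    z≤n

-- Limited packings

module _ (k : ℕ) (G : Graph n) where

  ∣∣≤L : {B : Subset n} → IsLimitedPacking k G B → ∣ B ∣ ≤ L k G
  ∣∣≤L lp = lookup (xs≤max 0 _)
    (∈-map⁺ ∣_∣ (∈-filter⁺ (isLimitedPacking? k G) (∈-subsets _) lp))

  ∣∣≤k⇒packing : {B : Subset n} → ∣ B ∣ ≤ k → IsLimitedPacking k G B
  ∣∣≤k⇒packing {B} ∣B∣≤k v = ≤-trans (∣p∩q∣≤∣q∣ (closedNeighbourhood G v) B) ∣B∣≤k

  L-attained : ∃[ B ] IsLimitedPacking k G B × ∣ B ∣ ≡ L k G
  L-attained = argmax-all id {P = λ m → ∃[ B ] IsLimitedPacking k G B × ∣ B ∣ ≡ m}
    -- The default 0 of `max` is realised by the empty packing.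
    (∅ , ∣∣≤k⇒packing (subst (_≤ k) (sym (∣⊥∣≡0 n)) z≤n) , ∣⊥∣≡0 n)
    (All-map⁺ (map-All (λ lp → _ , lp , refl) (all-filter (isLimitedPacking? k G) (subsets n))))

  k≤L : k ≤ n → k ≤ L k G
  k≤L k≤n with subset-of-size {n} full k (subst (k ≤_) (sym (∣⊤∣≡n n)) k≤n)
  ... | B , _ , refl = ∣∣≤L (∣∣≤k⇒packing {B} ≤-refl)

  -- A `(k+1)`-set fails to be a packing only if some closed neighbourhood contains all of it. A
  -- packing with more than `k` elements would contain a `(k+1)`-set, and a closed neighbourhood
  -- around that set would meet the packing too often.
  L≤k⇔ : L k G ≤ k ⇔ (∀ X → ∣ X ∣ ≡ suc k → ∃[ v ] X ⊆ closedNeighbourhood G v)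
  L≤k⇔ = mk⇔ dominated bound
    where
    dominated : L k G ≤ k → ∀ X → ∣ X ∣ ≡ suc k → ∃[ v ] X ⊆ closedNeighbourhood G v
    dominated L≤k X ∣X∣≡1+k
      -- `X` is too large to be a packing, and the bound is decidable at each vertex, so a finite
      -- search finds a vertex where it fails.
      with ¬∀⟶∃¬ n _ (λ v → ∣ closedNeighbourhood G v ∩ X ∣ ≤? k)
             (λ lp → <⇒≱ (subst (_≤ L k G) ∣X∣≡1+k (∣∣≤L lp)) L≤k)
    ... | v , ≰k = v , λ x∈X → p∩q⊆p _ X
      (p⊆q∧∣q∣≤∣p∣⇒q⊆p (p∩q⊆q (closedNeighbourhood G v) X) (≤-trans (≤-reflexive ∣X∣≡1+k) (≰⇒> ≰k)) x∈X)

    bound : (∀ X → ∣ X ∣ ≡ suc k → ∃[ v ] X ⊆ closedNeighbourhood G v) → L k G ≤ k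
    bound dom with L-attained
    ... | B , lp , ∣B∣≡L = ≮⇒≥ λ k<L → absurd (subset-of-size B (suc k) (subst (k <_) (sym ∣B∣≡L) k<L))
      where
      absurd : ¬ (∃[ X ] X ⊆ B × ∣ X ∣ ≡ suc k)
      absurd (X , X⊆B , ∣X∣≡1+k) with dom X ∣X∣≡1+k
      ... | v , X⊆N = <⇒≱ (≤-trans (≤-reflexive (sym ∣X∣≡1+k))
        (p⊆q⇒∣p∣≤∣q∣ {p = X} λ x∈X → x∈p∩q⁺ (X⊆N x∈X , X⊆B x∈X))) (lp v)

-- Vertices whose closed neighbourhood covers a given set

module _ (G : Graph n) (X : Subset n) where
  open Graph G

  private
    Ḡ = complement G

  -- For a vertex of `X`, covering `X` means being adjacent to every other vertex of the induced
  -- graph, that is, having the largest conceivable degree there.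
  covers-inside : (i : Fin ∣ X ∣) →
    X ⊆ closedNeighbourhood G (element X i) ⇔ suc (degree (induced G X) i) ≡ ∣ X ∣
  covers-inside i = mk⇔
    (λ (X⊆N : X ⊆ closedNeighbourhood G (element X i)) → from (degree-full (induced G X) i) λ j j≢i →
      adjacent j≢i (to (∈-closedNeighbourhood G _) (X⊆N (element-∈ X j))))
    (λ deg x∈X → from (∈-closedNeighbourhood G _) (cover deg (element-surjective X x∈X)))
    where
    adjacent : ∀ {j} → j ≢ i → element X j ≡ element X i ⊎ element X i ~ element X j →
               element X i ~ element X j
    adjacent j≢i (inj₁ eq)  = contradiction (element-injective X eq) j≢i
    adjacent j≢i (inj₂ i~j) = i~j

    cover : suc (degree (induced G X) i) ≡ ∣ X ∣ → ∀ {x} → ∃[ j ] element X j ≡ x →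
            x ≡ element X i ⊎ element X i ~ x
    cover deg (j , refl) with j ≟ i
    ... | yes refl = inj₁ refl
    ... | no  j≢i  = inj₂ (to (degree-full (induced G X) i) deg j j≢i)

  co-covers-inside : (i : Fin ∣ X ∣) →
    X ⊆ closedNeighbourhood Ḡ (element X i) ⇔ Isolated (induced G X) i
  co-covers-inside i = mk⇔
    (λ (X⊆N : X ⊆ closedNeighbourhood Ḡ (element X i)) → from (isolated⇔ (induced G X) i) λ j →
      nonadjacent (to (∈-closedNeighbourhood Ḡ _) (X⊆N (element-∈ X j))))
    (λ iso x∈X → from (∈-closedNeighbourhood Ḡ _) (cover iso (element-surjective X x∈X)))
    where
    nonadjacent : ∀ {j} → element X j ≡ element X i ⊎ Graph._~_ Ḡ (element X i) (element X j) →
                  ¬ element X i ~ element X j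
    nonadjacent (inj₁ eq)        = ~-irrefl (sym eq)
    nonadjacent (inj₂ (_ , i≁j)) = i≁j

    cover : Isolated (induced G X) i → ∀ {x} → ∃[ j ] element X j ≡ x →
            x ≡ element X i ⊎ Graph._~_ Ḡ (element X i) x
    cover iso (j , refl) with element X j ≟ element X i
    ... | yes eq = inj₁ eq
    ... | no  j≢i = inj₂ (j≢i ∘ sym , to (isolated⇔ (induced G X) i) iso j)

  covers-outside : {v : Fin n} → v ∉ X → X ⊆ closedNeighbourhood G v ⇔ AdjacentToAll G X v
  covers-outside {v} v∉X = mk⇔
    (λ (X⊆N : X ⊆ closedNeighbourhood G v) {_} x∈X →
      adjacent x∈X (to (∈-closedNeighbourhood G v) (X⊆N x∈X)))
    (λ (v~ : AdjacentToAll G X v) {_} x∈X →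
      from (∈-closedNeighbourhood G v) (inj₂ (v~ x∈X)))
    where
    adjacent : ∀ {x} → x ∈ X → x ≡ v ⊎ v ~ x → v ~ x
    adjacent x∈X (inj₁ refl) = contradiction x∈X v∉X
    adjacent x∈X (inj₂ v~x)  = v~x

  -- Here `v ∉ X` also supplies the distinctness that adjacency in the complement includes.
  co-covers-outside : {v : Fin n} → v ∉ X → X ⊆ closedNeighbourhood Ḡ v ⇔ AdjacentToNone G X v
  co-covers-outside {v} v∉X = mk⇔
    (λ (X⊆N : X ⊆ closedNeighbourhood Ḡ v) {_} x∈X →
      nonadjacent x∈X (to (∈-closedNeighbourhood Ḡ v) (X⊆N x∈X)))
    (λ (v≁ : AdjacentToNone G X v) {_} x∈X →
      from (∈-closedNeighbourhood Ḡ v) (inj₂ (v≢x x∈X , v≁ x∈X)))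
    where
    v≢x : ∀ {x} → x ∈ X → v ≢ x
    v≢x x∈X refl = v∉X x∈X

    nonadjacent : ∀ {x} → x ∈ X → x ≡ v ⊎ Graph._~_ Ḡ v x → ¬ v ~ x
    nonadjacent x∈X (inj₁ refl)      = contradiction x∈X v∉X
    nonadjacent x∈X (inj₂ (_ , v≁x)) = v≁x

  -- The cases are `v ∈ X`, recorded as a degree in the induced graph for use in (a), and `v ∉ X`,
  -- recorded as adjacency for (b) and (c).
  covered⇔ : (∃[ v ] X ⊆ closedNeighbourhood G v) ⇔
    ((∃[ i ] suc (degree (induced G X) i) ≡ ∣ X ∣) ⊎ (∃[ v ] v ∉ X × AdjacentToAll G X v))
  covered⇔ = mk⇔ split
    λ { (inj₁ (i , deg))      → element X i , from (covers-inside i) deg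
      ; (inj₂ (v , v∉X , v~)) → v , from (covers-outside v∉X) v~ }
    where
    split : (∃[ v ] X ⊆ closedNeighbourhood G v) →
      (∃[ i ] suc (degree (induced G X) i) ≡ ∣ X ∣) ⊎ (∃[ v ] v ∉ X × AdjacentToAll G X v)
    split (v , X⊆N) with v ∈? X
    ... | no v∉X = inj₂ (v , v∉X , to (covers-outside v∉X) X⊆N)
    ... | yes v∈X with element-surjective X v∈X
    ...   | i , refl = inj₁ (i , to (covers-inside i) X⊆N)

  co-covered⇔ : (∃[ v ] X ⊆ closedNeighbourhood Ḡ v) ⇔
    ((∃[ i ] Isolated (induced G X) i) ⊎ (∃[ v ] v ∉ X × AdjacentToNone G X v))
  co-covered⇔ = mk⇔ split
    λ { (inj₁ (i , iso))      → element X i , from (co-covers-inside i) iso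
      ; (inj₂ (v , v∉X , v≁)) → v , from (co-covers-outside v∉X) v≁ }
    where
    split : (∃[ v ] X ⊆ closedNeighbourhood Ḡ v) →
      (∃[ i ] Isolated (induced G X) i) ⊎ (∃[ v ] v ∉ X × AdjacentToNone G X v)
    split (v , X⊆N) with v ∈? X
    ... | no v∉X = inj₂ (v , v∉X , to (co-covers-outside v∉X) X⊆N)
    ... | yes v∈X with element-surjective X v∈X
    ...   | i , refl = inj₁ (i , to (co-covers-inside i) X⊆N)

-- Covering a set in a graph and in its complement

full-degree-and-isolated⇒n≡1 : (G : Graph n) (u v : Fin n) →
  suc (degree G u) ≡ n → Isolated G v → n ≡ 1
full-degree-and-isolated⇒n≡1 G u v deg iso with v ≟ u
-- If the two vertices coincide, the degree is both full and 0; if not, they are both adjacent and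
-- nonadjacent.
... | yes refl = trans (sym deg) (cong suc iso)
... | no  v≢u  =
  contradiction (Graph.~-sym G (to (degree-full G u) deg v v≢u)) (to (isolated⇔ G v) iso u)

CoveredTwice : Graph n → Subset n → Set
CoveredTwice G X =
  (∃[ v ] X ⊆ closedNeighbourhood G v) × (∃[ w ] X ⊆ closedNeighbourhood (complement G) w)

-- Each covering vertex is inside or outside `X`, which gives four cases. The bound `1 ≤ k` excludes
-- the case of both inside and, conversely, makes the maximum degree in (a) positive, hence
-- attained.
coveredTwice⇔ : (k : ℕ) → 1 ≤ k → (G : Graph n) (X : Subset n) → ∣ X ∣ ≡ suc k →
  CoveredTwice G X ⇔ (ConditionA k G X ⊎ ConditionB G X ⊎ ConditionC G X)
coveredTwice⇔ k 1≤k G X ∣X∣≡1+k = mk⇔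
  (λ (c , c̄) → conditions (to (covered⇔ G X) c) (to (co-covered⇔ G X) c̄)) covered
  where
  x₀∈X : ∃[ x ] x ∈ X
  x₀∈X = element X i , element-∈ X i
    where
    i : Fin ∣ X ∣
    i = subst Fin (sym ∣X∣≡1+k) zero

  conditions :
    (∃[ i ] suc (degree (induced G X) i) ≡ ∣ X ∣) ⊎ (∃[ v ] v ∉ X × AdjacentToAll G X v) →
    (∃[ i ] Isolated (induced G X) i) ⊎ (∃[ v ] v ∉ X × AdjacentToNone G X v) →
    ConditionA k G X ⊎ ConditionB G X ⊎ ConditionC G X
  -- Both inside would force `∣ X ∣ ≡ 1`, that is, `k ≡ 0`.
  conditions (inj₁ (i , deg)) (inj₁ (j , iso)) = contradiction
    (suc-injective (trans (sym ∣X∣≡1+k) (full-degree-and-isolated⇒n≡1 (induced G X) i j deg iso)))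
    λ { refl → <⇒≱ 1≤k z≤n }
  conditions (inj₁ (i , deg)) (inj₂ none) =
    inj₁ (trans (maxDegree≡ (induced G X) i deg) (suc-injective (trans deg ∣X∣≡1+k)) , none)
  conditions (inj₂ all) (inj₁ iso) = inj₂ (inj₁ (all , iso))
  -- The vertices `v` and `w` differ because an element of the nonempty `X` is adjacent to one and
  -- not to the other.
  conditions (inj₂ (v , v∉X , v~)) (inj₂ (w , w∉X , w≁)) = inj₂ (inj₂
    (v , w , (λ { refl → w≁ (proj₂ x₀∈X) (v~ (proj₂ x₀∈X)) }) , (v∉X , v~) , (w∉X , w≁)))

  covered : ConditionA k G X ⊎ ConditionB G X ⊎ ConditionC G X → CoveredTwice G X
  covered (inj₁ (Δ≡k , none))
    with maxDegree-attained (induced G X) (subst (1 ≤_) (sym Δ≡k) 1≤k)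
  ... | i , deg≡Δ =
    from (covered⇔ G X) (inj₁ (i , trans (cong suc (trans deg≡Δ Δ≡k)) (sym ∣X∣≡1+k))) ,
    from (co-covered⇔ G X) (inj₂ none)
  covered (inj₂ (inj₁ (all , iso))) =
    from (covered⇔ G X) (inj₂ all) , from (co-covered⇔ G X) (inj₁ iso)
  covered (inj₂ (inj₂ (v , w , _ , all , none))) =
    from (covered⇔ G X) (inj₂ (v , all)) , from (co-covered⇔ G X) (inj₂ (w , none))

-- The lower bound and the case of equality

2*k≡k+k : ∀ k → 2 * k ≡ k + k
2*k≡k+k k = cong (k +_) (+-identityʳ k)

-- Cancel `k` in `k + m ≤ n + m ≤ k + k`. Applied to the two packing numbers, it caps each at `k`,
-- since the other is at least `k`.
m+n≤2*k⇒m≤k : ∀ {k m n} → k ≤ n → m + n ≤ 2 * k → m ≤ k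
m+n≤2*k⇒m≤k {k} {m} {n} k≤n m+n≤2*k = +-cancelˡ-≤ k m k
  (≤-trans (+-monoˡ-≤ m k≤n) (subst (_≤ k + k) (+-comm m n) (subst (m + n ≤_) (2*k≡k+k k) m+n≤2*k)))

proposition3p12 : ∀ (k n : ℕ) (G : Graph n) → 1 ≤ k → 2 ≤ n → k ≤ n →
    (2 * k ≤ L k G + L k (complement G)) ×
    ((L k G + L k (complement G) ≡ 2 * k) ⇔ (n ≡ k ⊎ PropertyII k G))
proposition3p12 k n G 1≤k _ k≤n = 2k≤sum , mk⇔ forward backward
  where
  k≤LG : k ≤ L k G
  k≤LG = k≤L k G k≤n

  k≤LḠ : k ≤ L k (complement G)
  k≤LḠ = k≤L k (complement G) k≤n

  2k≤sum : 2 * k ≤ L k G + L k (complement G)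
  2k≤sum = subst (_≤ L k G + L k (complement G)) (sym (2*k≡k+k k)) (+-mono-≤ k≤LG k≤LḠ)

  forward : L k G + L k (complement G) ≡ 2 * k → n ≡ k ⊎ PropertyII k G
  forward sum≡2k with n ≟ⁿ k
  ... | yes n≡k = inj₁ n≡k
  ... | no  n≢k = inj₂ (≤∧≢⇒< k≤n (n≢k ∘ sym) , λ X ∣X∣≡1+k →
    to (coveredTwice⇔ k 1≤k G X ∣X∣≡1+k)
      ( to (L≤k⇔ k G) (m+n≤2*k⇒m≤k k≤LḠ sum≤2k) X ∣X∣≡1+k
      , to (L≤k⇔ k (complement G)) (m+n≤2*k⇒m≤k k≤LG (subst (_≤ 2 * k) (+-comm (L k G) _) sum≤2k))
          X ∣X∣≡1+k))
    where
    sum≤2k : L k G + L k (complement G) ≤ 2 * k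
    sum≤2k = ≤-reflexive sum≡2k

  all-coveredTwice : n ≡ k ⊎ PropertyII k G → ∀ X → ∣ X ∣ ≡ suc k → CoveredTwice G X
  -- A graph with only `k` vertices has no `(k+1)`-set, so the requirement is vacuous.
  all-coveredTwice (inj₁ refl)       X ∣X∣≡1+k =
    contradiction (∣p∣≤n X) (<⇒≱ (≤-reflexive (sym ∣X∣≡1+k)))
  all-coveredTwice (inj₂ (_ , conds)) X ∣X∣≡1+k =
    from (coveredTwice⇔ k 1≤k G X ∣X∣≡1+k) (conds X ∣X∣≡1+k)

  backward : n ≡ k ⊎ PropertyII k G → L k G + L k (complement G) ≡ 2 * k
  backward prop = ≤-antisym
    (subst (L k G + L k (complement G) ≤_) (sym (2*k≡k+k k)) (+-mono-≤
      (from (L≤k⇔ k G) λ X ∣X∣≡1+k → proj₁ (all-coveredTwice prop X ∣X∣≡1+k))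
      (from (L≤k⇔ k (complement G)) λ X ∣X∣≡1+k → proj₂ (all-coveredTwice prop X ∣X∣≡1+k))))
    2k≤sum
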